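{- Let $\mathcal{B}$ be a Turing-complete basis of primitive combinators. Then asymptotically almost no $\mathcal{B}$-combinator is in normal form, simply typeable, or strongly normalising. That is, for each of the three properties $A$ ("is in normal form", "is typeable in $TA_{\mathcal{B}}$", "is strongly normalising"), $$\lim_{n\to\infty}\frac{|\{P\in\mathcal{C}_{\mathcal{B}} : |P|=n,\ P \text{ has property } A\}|}{|\{P\in\mathcal{C}_{\mathcal{B}} : |P|=n\}|}=0 .$$
   Context: Combinators. Let $\mathcal{B}$ be a finite basis of primitive combinators. The set $\mathcal{C}_{\mathcal{B}}$ of $\mathcal{B}$-combinators is the smallest set containing $\mathcal{B}$ and closed under application $(N,M)\mapsto (NM)$; application associates to the left. The size $|P|$ is the number of applications in $P$ (combinators are identified with plane binary trees with leaves labelled by $\mathcal{B}$; size is the number of binary nodes). Reduction. Each primitive $\mathbf{X}\in\mathcal{B}$ comes with one reduction rule $\mathbf{X}N_1\ldots N_m\to M$ with $m\ge 1$, where $N_1,\ldots,N_m$ are arbitrary combinators and $M$ is a fixed term built from $N_1,\ldots,N_m$ by application. The relation is extended so that $P\to Q$ implies $PR\to QR$ and $RP\to RQ$ for every combinator $R$. $P$ is in normal form if there is no $Q$ with $P\to Q$. $P$ is strongly normalising if there is no infinite sequence $P=P_0\to P_1\to\cdots$. Turing-completeness. $\mathcal{B}$ is Turing-complete if there are $\mathcal{B}$-combinators extensionally equivalent to $\mathbf{S}$ and to $\mathbf{K}$, where $\mathbf{S}xyz\to xz(yz)$ and $\mathbf{K}xy\to x$. Here a $\mathcal{B}$-combinator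 $N$ is extensionally equivalent to $\mathbf{S}$ (resp. $\mathbf{K}$) if, over terms built from $\mathcal{B}$ and fresh variables $x,y,z$, $Nxyz$ is convertible to $xz(yz)$ (resp. $Nxy$ is convertible to $x$), convertibility being the equivalence relation generated by $\to$. Typing. Types are simple types built from type variables by $\to$. The system $TA_{\mathbf{S}\mathbf{K}}$ has axiom schemes $\mathbf{S}:(\alpha\to\beta\to\gamma)\to(\alpha\to\beta)\to\alpha\to\gamma$ and $\mathbf{K}:\alpha\to\beta\to\alpha$, and the rule modus ponens: from $N:\alpha\to\beta$ and $M:\alpha$ infer $(NM):\beta$. For a Turing-complete basis $\mathcal{B}$ it is assumed that $\mathcal{B}$ defines axiom schemes, one for each primitive combinator, such that, together with modus ponens, the resulting system $TA_{\mathcal{B}}$ is sound in the following sense: if a $\mathcal{B}$-combinator $N$ is extensionally equivalent to $\mathbf{S}$ (resp. $\mathbf{K}$), then the types of $N$ in $TA_{\mathcal{B}}$ are the same as the types of $\mathbf{S}$ (resp. $\mathbf{K}$) in $TA_{\mathbf{S}\mathbf{K}}$. A $\mathcal{B}$-combinator $P$ is (simply) typeable if $P:\alpha$ is derivable in $TA_{\mathcal{B}}$ for some type $\alpha$. -}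

module Defs where

open import Data.Empty using (⊥; ⊥-elim)
open import Data.Fin using (Fin; zero; suc)
open import Data.List using (List; length)
open import Data.List.Membership.Propositional using (_∈_)
open import Data.List.Relation.Unary.All using (All)
open import Data.List.Relation.Unary.Unique.Propositional using (Unique)
open import Data.Nat using (ℕ; zero; suc; _+_; _*_; _≤_; _<_)
open import Data.Product using (Σ; ∃; ∃-syntax; _×_)
open import Data.Vec using (Vec; []; _∷_; lookup)
open import Function using (_⇔_)
open import Relation.Binary.Construct.Closure.Equivalence using (EqClosure)
open import Relation.Binary.PropositionalEquality using (_≡_)
open import Relation.Nullary using (¬_)

infixl 9 _·_

data Term (P V : Set) : Set where
  prim : P → Term P V
  var  : V → Term P V
  _·_  : Term P V → Term P V → Term P V

bind : ∀ {P Q V W : Set} → (P → Term Q W) → (V → Term Q W) → Term P V → Term Q W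
bind f g (prim X) = f X
bind f g (var v)  = g v
bind f g (M · N)  = bind f g M · bind f g N

size : ∀ {P V : Set} → Term P V → ℕ
size (prim _) = 0
size (var _)  = 0
size (M · N)  = suc (size M + size N)

applyTo : ∀ {P V : Set} {m : ℕ} → Term P V → Vec (Term P V) m → Term P V
applyTo M []       = M
applyTo M (N ∷ Ns) = applyTo (M · N) Ns

-- The rule of X is  X N₁ … N_m → M  with m = arity X, where M is given as a
-- primitive-free term in m variables. Such a term has at least one leaf, so
-- the existence of rhs X already forces arity X ≥ 1.
record Basis : Set where
  field
    card  : ℕ
    arity : Fin card → ℕ
    rhs   : (X : Fin card) → Term ⊥ (Fin (arity X))

  Prim : Set
  Prim = Fin card

module _ (B : Basis) where
  open Basis B

  Combinator : Set
  Combinator = Term Prim ⊥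

  data Step {V : Set} : Term Prim V → Term Prim V → Set where
    contract : (X : Prim) (Ns : Vec (Term Prim V) (arity X)) →
               Step (applyTo (prim X) Ns) (bind ⊥-elim (lookup Ns) (rhs X))
    appˡ     : ∀ {P Q} (R : Term Prim V) → Step P Q → Step (P · R) (Q · R)
    appʳ     : ∀ {P Q} (R : Term Prim V) → Step P Q → Step (R · P) (R · Q)

  Convertible : {V : Set} → Term Prim V → Term Prim V → Set
  Convertible = EqClosure Step

  NormalForm : Combinator → Set
  NormalForm P = ¬ (∃[ Q ] Step P Q)

  StronglyNormalising : Combinator → Set
  StronglyNormalising P =
    ¬ (Σ (ℕ → Combinator) λ f → f 0 ≡ P × (∀ i → Step (f i) (f (suc i))))

  private
    x y z : Term Prim (Fin 3)
    x = var zero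
    y = var (suc zero)
    z = var (suc (suc zero))

    ⌈_⌉ : Combinator → Term Prim (Fin 3)
    ⌈_⌉ = bind prim ⊥-elim

  ExtEqS : Combinator → Set
  ExtEqS N = Convertible (⌈ N ⌉ · x · y · z) (x · z · (y · z))

  ExtEqK : Combinator → Set
  ExtEqK N = Convertible (⌈ N ⌉ · x · y) x

  TuringComplete : Set
  TuringComplete = ∃ ExtEqS × ∃ ExtEqK

infixr 7 _⇒_

data Type : Set where
  tvar : ℕ → Type
  _⇒_  : Type → Type → Type

substitute : (ℕ → Type) → Type → Type
substitute σ (tvar i) = σ i
substitute σ (α ⇒ β)  = substitute σ α ⇒ substitute σ β

-- The axiom scheme of X is the set of all substitution instances of τ X.
data Typing {P : Set} (τ : P → Type) : Term P ⊥ → Type → Set where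
  axiom : (X : P) (σ : ℕ → Type) → Typing τ (prim X) (substitute σ (τ X))
  mp    : ∀ {N M α β} → Typing τ N (α ⇒ β) → Typing τ M α → Typing τ (N · M) β

data SK : Set where
  𝐒 𝐊 : SK

schemeSK : SK → Type
schemeSK 𝐒 = (a ⇒ b ⇒ c) ⇒ (a ⇒ b) ⇒ a ⇒ c
  where
  a = tvar 0
  b = tvar 1
  c = tvar 2
schemeSK 𝐊 = tvar 0 ⇒ tvar 1 ⇒ tvar 0

module _ (B : Basis) where
  open Basis B

  Typeable : (Prim → Type) → Combinator B → Set
  Typeable τ P = ∃[ α ] Typing τ P α

  Sound : (Prim → Type) → Set
  Sound τ =
    (∀ N → ExtEqS B N → ∀ α → Typing τ N α ⇔ Typing schemeSK (prim 𝐒) α) ×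
    (∀ N → ExtEqK B N → ∀ α → Typing τ N α ⇔ Typing schemeSK (prim 𝐊) α)

  -- Only the forward inclusion of Sound. No Turing-complete basis satisfies
  -- Sound: if N, M are equivalent to S, K and Ω is N I I (N I I) with
  -- I = N M M, then M N Ω is again equivalent to S, but it contains Ω and so,
  -- unlike S, has no type. The inclusion alone does not have this defect.
  SoundInclusion : (Prim → Type) → Set
  SoundInclusion τ =
    (∀ N → ExtEqS B N → ∀ α → Typing τ N α → Typing schemeSK (prim 𝐒) α) ×
    (∀ N → ExtEqK B N → ∀ α → Typing τ N α → Typing schemeSK (prim 𝐊) α)

  HasCardinality : (Combinator B → Set) → ℕ → Set
  HasCardinality S c =
    ∃[ xs ] Unique xs × (∀ P → P ∈ xs ⇔ S P) × length xs ≡ c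

  -- |{P : |P| = n, A P}| / |{P : |P| = n}| tends to 0, with 1/k in the role of
  -- ε and the denominator cleared. As A need not be decidable, the numerator is
  -- bounded through every duplicate-free list xs of combinators of size n
  -- satisfying A; the longest such list enumerates them all.
  AsymptoticallyAlmostNo : (Combinator B → Set) → Set
  AsymptoticallyAlmostNo A =
    ∀ (k : ℕ) → ∃[ n₀ ] ∀ n → n₀ ≤ n →
      ∃[ c ] HasCardinality (λ P → size P ≡ n) c ×
             (∀ xs → Unique xs → All (λ P → size P ≡ n × A P) xs → k * length xs < c)

{-# OPTIONS --safe #-}
module Submission where

-- Each of the three properties excludes a fixed subterm M: a redex, a combinator Ω with a
-- reduction Ω ⟶⁺ Ω, and an untypeable combinator, respectively. Replacing the subterm Q at one of
-- the 2n + 1 nodes of an M-free combinator of size n by Q · M creates exactly one occurrence of M,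
-- so the node can be recovered and (2n + 1) aₙ ≤ c₍ₙ₊₁₊|M|₎, where aₙ and cₙ count the M-free and
-- all combinators of size n. With b primitives, (n + 2) cₙ₊₁ = 2b (2n + 1) cₙ, hence cₙ₊₁ ≤ 4b cₙ and
-- aₙ / cₙ = O(1 / n).
--
-- If N and M represent S and K, put I = N M M and ω = N I I. By confluence, N and M reduce like S and
-- K, so Ω = ω ω reduces to itself. Every type of I has the form β ⇒ β, which leaves no type for ω.

open import Defs
open import Data.Empty using (⊥; ⊥-elim)
open import Data.Fin using (Fin)
import Data.Fin.Properties as Fin
open import Data.List using (List; []; _∷_; _++_; length; map; concatMap; cartesianProductWith; allFin)
open import Data.List.Membership.Propositional using (_∈_; find)
open import Data.List.Membership.Propositional.Properties
  using (∈-∃++; ∈-++⁺ˡ; ∈-++⁺ʳ; ∈-++⁻; ∈-map⁺; ∈-map⁻; ∈-allFin; ∈-cartesianProductWith⁺;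
         ∈-cartesianProductWith⁻; ∈-concatMap⁻; ∈-length)
open import Data.List.Properties using (length-++; length-++-sucʳ; length-map)
open import Data.List.Relation.Binary.Subset.Propositional using (_⊆_)
open import Data.List.Relation.Unary.All as All using (All; []; _∷_)
open import Data.List.Relation.Unary.All.Properties using (All¬⇒¬Any; ¬Any⇒All¬)
open import Data.List.Relation.Unary.AllPairs using ([]; _∷_)
open import Data.List.Relation.Unary.Any using (here; there)
open import Data.List.Relation.Unary.Unique.Propositional using (Unique)
import Data.List.Relation.Unary.Unique.Propositional.Properties as Unique
open import Data.Maybe using (Maybe; just; nothing)
open import Data.Maybe.Properties using (just-injective)
open import Data.Nat using (ℕ; zero; suc; _+_; _*_; _^_; _≤_; _<_; z≤n; s≤s; s≤s⁻¹)
open import Data.Nat.Induction using (<-rec)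
open import Data.Nat.Properties
open import Data.Nat.Tactic.RingSolver using (solve-∀)
open import Data.Product using (Σ; ∃; ∃₂; ∃-syntax; _×_; _,_; proj₁; proj₂)
open import Data.Sum using (_⊎_; inj₁; inj₂)
open import Data.Vec as Vec using (Vec; []; _∷_; lookup; replicate)
open import Data.Vec.Properties using (lookup-map)
open import Data.Vec.Relation.Binary.Pointwise.Inductive as Pointwise using (Pointwise; []; _∷_)
open import Data.Vec.Relation.Unary.All as Allᵛ using ([]; _∷_) renaming (All to Allᵛ)
open import Function using (_∘_; _⇔_; mk⇔; Equivalence)
open import Relation.Binary.Construct.Closure.ReflexiveTransitive as Star using (Star; ε; _◅_; _◅◅_)
open import Relation.Binary.Definitions using (DecidableEquality)
open import Relation.Binary.PropositionalEquality
  using (_≡_; _≢_; refl; sym; trans; cong; cong₂; subst; subst₂; module ≡-Reasoning)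
open import Relation.Binary.Rewriting using (Confluent; conf⇒nf)
open import Relation.Nullary using (¬_; yes; no; contradiction)
open import Relation.Nullary.Decidable as Dec using (_×-dec_)

-- Convolution and the growth of its fixed point

conv : (ℕ → ℕ) → (ℕ → ℕ) → ℕ → ℕ
conv f g zero    = f 0 * g 0
conv f g (suc n) = f 0 * g (suc n) + conv (f ∘ suc) g n

conv-cong : ∀ {f f′ g g′} n → (∀ i → i ≤ n → f i ≡ f′ i) → (∀ i → i ≤ n → g i ≡ g′ i) →
            conv f g n ≡ conv f′ g′ n
conv-cong zero    ff gg = cong₂ _*_ (ff 0 z≤n) (gg 0 z≤n)
conv-cong (suc n) ff gg =
  cong₂ _+_ (cong₂ _*_ (ff 0 z≤n) (gg (suc n) ≤-refl))
            (conv-cong n (λ i i≤n → ff (suc i) (s≤s i≤n)) (λ i i≤n → gg i (m≤n⇒m≤1+n i≤n)))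

conv-scale : ∀ k f g n → conv (λ i → k * f i) g n ≡ k * conv f g n
conv-scale k f g zero    = *-assoc k (f 0) (g 0)
conv-scale k f g (suc n) = begin
  k * f 0 * g (suc n) + conv (λ i → k * f (suc i)) g n
    ≡⟨ cong₂ _+_ (*-assoc k (f 0) (g (suc n))) (conv-scale k (f ∘ suc) g n) ⟩
  k * (f 0 * g (suc n)) + k * conv (f ∘ suc) g n
    ≡⟨ *-distribˡ-+ k _ _ ⟨
  k * conv f g (suc n) ∎
  where open ≡-Reasoning

conv-sucʳ : ∀ f g n → conv f g (suc n) ≡ conv f (g ∘ suc) n + f (suc n) * g 0
conv-sucʳ f g zero    = refl
conv-sucʳ f g (suc n) =
  trans (cong (f 0 * g (suc (suc n)) +_) (conv-sucʳ (f ∘ suc) g n))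
        (sym (+-assoc (f 0 * g (suc (suc n))) _ _))

conv-comm : ∀ f g n → conv f g n ≡ conv g f n
conv-comm f g zero    = *-comm (f 0) (g 0)
conv-comm f g (suc n) = begin
  f 0 * g (suc n) + conv (f ∘ suc) g n ≡⟨ cong₂ _+_ (*-comm (f 0) _) (conv-comm (f ∘ suc) g n) ⟩
  g (suc n) * f 0 + conv g (f ∘ suc) n ≡⟨ +-comm (g (suc n) * f 0) _ ⟩
  conv g (f ∘ suc) n + g (suc n) * f 0 ≡⟨ conv-sucʳ g f n ⟨
  conv g f (suc n)                     ∎
  where open ≡-Reasoning

-- Each product `f i * g j` with `i + j` equal to `n` gets the factor `u i` from the first sum and
-- `v j` from the second, in total `w`. The induction shifts `u` and `f` together.
conv-weights : (u v f g : ℕ → ℕ) (w n : ℕ) → (∀ i j → i + j ≡ n → u i + v j ≡ w) →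
               conv (λ i → u i * f i) g n + conv f (λ j → v j * g j) n ≡ w * conv f g n
conv-weights u v f g w zero    eq =
  trans (lemma (u 0) (f 0) (g 0) (v 0)) (cong (_* (f 0 * g 0)) (eq 0 0 refl))
  where
  lemma : ∀ a x y b → a * x * y + x * (b * y) ≡ (a + b) * (x * y)
  lemma = solve-∀
conv-weights u v f g w (suc n) eq = begin
  u 0 * f 0 * g (suc n) + conv (λ i → u (suc i) * f (suc i)) g n
    + (f 0 * (v (suc n) * g (suc n)) + conv (f ∘ suc) (λ j → v j * g j) n)
    ≡⟨ lemma (u 0) (f 0) (g (suc n)) (v (suc n)) _ _ ⟩
  (u 0 + v (suc n)) * (f 0 * g (suc n))
    + (conv (λ i → u (suc i) * f (suc i)) g n + conv (f ∘ suc) (λ j → v j * g j) n)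
    ≡⟨ cong₂ _+_ (cong (_* (f 0 * g (suc n))) (eq 0 (suc n) refl))
         (conv-weights (u ∘ suc) v (f ∘ suc) g w n (λ i j i+j≡n → eq (suc i) j (cong suc i+j≡n))) ⟩
  w * (f 0 * g (suc n)) + w * conv (f ∘ suc) g n
    ≡⟨ *-distribˡ-+ w _ _ ⟨
  w * conv f g (suc n) ∎
  where
  open ≡-Reasoning
  lemma : ∀ a x y b p q → a * x * y + p + (x * (b * y) + q) ≡ (a + b) * (x * y) + (p + q)
  lemma = solve-∀

-- Commutativity moves the weight onto the second factor, so the doubled sum carries `u i + u j` on
-- each product.
conv-symmetrise : (u f : ℕ → ℕ) (w n : ℕ) → (∀ i j → i + j ≡ n → u i + u j ≡ w) →
                  2 * conv (λ i → u i * f i) f n ≡ w * conv f f n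
conv-symmetrise u f w n eq = begin
  2 * conv uf f n             ≡⟨ cong (conv uf f n +_) (+-identityʳ _) ⟩
  conv uf f n + conv uf f n   ≡⟨ cong (conv uf f n +_) (conv-comm uf f n) ⟩
  conv uf f n + conv f uf n   ≡⟨ conv-weights u u f f w n eq ⟩
  w * conv f f n              ∎
  where
  open ≡-Reasoning
  uf : ℕ → ℕ
  uf i = u i * f i

-- The recurrence of the Catalan numbers: `c n` is `c 0 ^ (1 + n)` times the n-th one, and `c-ratio`
-- is their ratio formula with denominators cleared.
module Growth (c : ℕ → ℕ) (c-suc : ∀ n → c (suc n) ≡ conv c c n) where

  -- Symmetrising the convolution weighted by 1 + i gives the factor 3 + n. Shifted by one, that weight
  -- meets the induction hypothesis, whose weight 1 + 2i can be symmetrised again.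
  c-ratio : ∀ n → (2 + n) * c (suc n) ≡ 2 * c 0 * ((1 + 2 * n) * c n)
  c-ratio = <-rec _ step
    where
    open ≡-Reasoning
    step : ∀ n → (∀ {i} → i < n → (2 + i) * c (suc i) ≡ 2 * c 0 * ((1 + 2 * i) * c i)) →
           (2 + n) * c (suc n) ≡ 2 * c 0 * ((1 + 2 * n) * c n)
    step zero    _  = trans (cong (2 *_) (c-suc 0)) (lemma (c 0))
      where
      lemma : ∀ b → 2 * (b * b) ≡ 2 * b * (1 * b)
      lemma = solve-∀
    step (suc n) ih = begin
      (3 + n) * c (2 + n)
        ≡⟨ cong ((3 + n) *_) (c-suc (suc n)) ⟩
      (3 + n) * conv c c (suc n)
        ≡⟨ conv-symmetrise suc c (3 + n) (suc n)
             (λ i j eq → trans (cong suc (+-suc i j)) (cong (2 +_) eq)) ⟨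
      2 * (1 * c 0 * c (suc n) + conv (λ i → (2 + i) * c (suc i)) c n)
        ≡⟨ cong (λ t → 2 * (1 * c 0 * c (suc n) + t))
             (conv-cong {f = λ i → (2 + i) * c (suc i)} n (λ i i≤n → ih (s≤s i≤n)) (λ _ _ → refl)) ⟩
      2 * (1 * c 0 * c (suc n) + conv (λ i → 2 * c 0 * ((1 + 2 * i) * c i)) c n)
        ≡⟨ cong (λ t → 2 * (1 * c 0 * c (suc n) + t)) (conv-scale (2 * c 0) _ c n) ⟩
      2 * (1 * c 0 * c (suc n) + 2 * c 0 * conv (λ i → (1 + 2 * i) * c i) c n)
        ≡⟨ lemma₁ (c 0) (c (suc n)) _ ⟩
      2 * c 0 * c (suc n) + 2 * c 0 * (2 * conv (λ i → (1 + 2 * i) * c i) c n)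
        ≡⟨ cong (λ t → 2 * c 0 * c (suc n) + 2 * c 0 * t)
             (conv-symmetrise (λ i → 1 + 2 * i) c (2 + 2 * n) n
               (λ i j eq → trans (lemma₂ i j) (cong (λ t → 2 + 2 * t) eq))) ⟩
      2 * c 0 * c (suc n) + 2 * c 0 * ((2 + 2 * n) * conv c c n)
        ≡⟨ cong (λ t → 2 * c 0 * c (suc n) + 2 * c 0 * ((2 + 2 * n) * t)) (c-suc n) ⟨
      2 * c 0 * c (suc n) + 2 * c 0 * ((2 + 2 * n) * c (suc n))
        ≡⟨ lemma₃ (c 0) (c (suc n)) n ⟩
      2 * c 0 * ((1 + 2 * suc n) * c (suc n)) ∎
      where
      lemma₁ : ∀ b x y → 2 * (1 * b * x + 2 * b * y) ≡ 2 * b * x + 2 * b * (2 * y)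
      lemma₁ = solve-∀
      lemma₂ : ∀ i j → 1 + 2 * i + (1 + 2 * j) ≡ 2 + 2 * (i + j)
      lemma₂ = solve-∀
      lemma₃ : ∀ b x n → 2 * b * x + 2 * b * ((2 + 2 * n) * x) ≡ 2 * b * ((1 + 2 * (1 + n)) * x)
      lemma₃ = solve-∀

  c-suc≤ : ∀ n → c (suc n) ≤ 4 * c 0 * c n
  c-suc≤ n = *-cancelˡ-≤ (2 + n) (begin
    -- The added `3 * c n` raises the factor `1 + 2 * n` to `2 * (2 + n)`, from which `2 + n`
    -- cancels.
    (2 + n) * c (suc n)                        ≡⟨ c-ratio n ⟩
    2 * c 0 * ((1 + 2 * n) * c n)              ≤⟨ m≤m+n _ (2 * c 0 * (3 * c n)) ⟩
    2 * c 0 * ((1 + 2 * n) * c n) + 2 * c 0 * (3 * c n) ≡⟨ lemma (c 0) n (c n) ⟩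
    (2 + n) * (4 * c 0 * c n)                  ∎)
    where
    open ≤-Reasoning
    lemma : ∀ b n x → 2 * b * ((1 + 2 * n) * x) + 2 * b * (3 * x) ≡ (2 + n) * (4 * b * x)
    lemma = solve-∀

  c-+≤ : ∀ k n → c (k + n) ≤ (4 * c 0) ^ k * c n
  c-+≤ zero    n = ≤-reflexive (sym (*-identityˡ (c n)))
  c-+≤ (suc k) n = begin
    c (suc (k + n))                     ≤⟨ c-suc≤ (k + n) ⟩
    4 * c 0 * c (k + n)                 ≤⟨ *-monoʳ-≤ (4 * c 0) (c-+≤ k n) ⟩
    4 * c 0 * ((4 * c 0) ^ k * c n)     ≡⟨ *-assoc (4 * c 0) _ (c n) ⟨
    (4 * c 0) ^ suc k * c n             ∎
    where open ≤-Reasoning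

-- Counting by duplicate-free lists

module _ {A : Set} where

  -- Pigeonhole by removal: the head `x` is cut out of `ys`, and the rest of `xs`, in which `x` does
  -- not recur, still lies in what remains.
  length-mono-⊆ : {xs ys : List A} → Unique xs → xs ⊆ ys → length xs ≤ length ys
  length-mono-⊆ []             _     = z≤n
  length-mono-⊆ {x ∷ xs} (x∉xs ∷ xs!) xs⊆ys with ∈-∃++ (xs⊆ys (here refl))
  ... | as , bs , refl = begin
    suc (length xs)         ≤⟨ s≤s (length-mono-⊆ xs! xs⊆as++bs) ⟩
    suc (length (as ++ bs)) ≡⟨ length-++-sucʳ as x bs ⟨
    length (as ++ x ∷ bs)   ∎
    where
    open ≤-Reasoning
    xs⊆as++bs : xs ⊆ as ++ bs
    xs⊆as++bs y∈xs with ∈-++⁻ as (xs⊆ys (there y∈xs))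
    ... | inj₁ y∈as         = ∈-++⁺ˡ y∈as
    ... | inj₂ (here refl)  = contradiction y∈xs (All¬⇒¬Any x∉xs)
    ... | inj₂ (there y∈bs) = ∈-++⁺ʳ as y∈bs

  -- The left inverse `g` keeps the blocks `f x` disjoint. It is required only on members of `xs`,
  -- since `erase` undoes insertions only into `M`-free terms.
  concatMap-unique : {C : Set} (f : A → List C) (g : C → A) {xs : List A} → Unique xs →
                     All (λ x → Unique (f x)) xs → All (λ x → ∀ {y} → y ∈ f x → g y ≡ x) xs →
                     Unique (concatMap f xs)
  concatMap-unique f g []           []       []       = []
  concatMap-unique f g {x ∷ xs} (x∉xs ∷ xs!) (fx! ∷ fxs!) (inv ∷ invs) =
    Unique.++⁺ fx! (concatMap-unique f g xs! fxs! invs) disjoint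
    where
    disjoint : ∀ {y} → ¬ (y ∈ f x × y ∈ concatMap f xs)
    disjoint (y∈fx , y∈fxs) with find (∈-concatMap⁻ f {xs = xs} y∈fxs)
    ... | x′ , x′∈xs , y∈fx′ with trans (sym (inv y∈fx)) (All.lookup invs x′∈xs y∈fx′)
    ...   | refl = All¬⇒¬Any x∉xs x′∈xs

  length-concatMap : {C : Set} (f : A → List C) (k : ℕ) {xs : List A} →
                     All (λ x → length (f x) ≡ k) xs → length (concatMap f xs) ≡ length xs * k
  length-concatMap f k []         = refl
  length-concatMap f k {x ∷ xs} (eq ∷ eqs) =
    trans (length-++ (f x)) (cong₂ _+_ eq (length-concatMap f k eqs))

length-cartesianProductWith : {A B C : Set} (f : A → B → C) (xs : List A) (ys : List B) →
  length (cartesianProductWith f xs ys) ≡ length xs * length ys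
length-cartesianProductWith f []       ys = refl
length-cartesianProductWith f (x ∷ xs) ys =
  trans (length-++ (map (f x) ys))
        (cong₂ _+_ (length-map (f x) ys) (length-cartesianProductWith f xs ys))


-- Enumerating combinators by size

·-injective : ∀ {P V : Set} {A B C D : Term P V} → A · B ≡ C · D → A ≡ C × B ≡ D
·-injective refl = refl , refl

module Enumeration (b : ℕ) where

  Closed : Set
  Closed = Term (Fin b) ⊥

  -- Follows the recursion of `conv` clause by clause, so that lengths become convolutions.
  products : (ℕ → List Closed) → (ℕ → List Closed) → ℕ → List Closed
  products f g zero    = cartesianProductWith _·_ (f 0) (g 0)
  products f g (suc n) = cartesianProductWith _·_ (f 0) (g (suc n)) ++ products (f ∘ suc) g n

  length-products : ∀ f g n → length (products f g n) ≡ conv (length ∘ f) (length ∘ g) n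
  length-products f g zero    = length-cartesianProductWith _·_ (f 0) (g 0)
  length-products f g (suc n) =
    trans (length-++ (cartesianProductWith _·_ (f 0) (g (suc n))))
          (cong₂ _+_ (length-cartesianProductWith _·_ (f 0) (g (suc n)))
                     (length-products (f ∘ suc) g n))

  ∈-products⁺ : ∀ f g {A B} i j → A ∈ f i → B ∈ g j → A · B ∈ products f g (i + j)
  ∈-products⁺ f g zero    zero    A∈ B∈ = ∈-cartesianProductWith⁺ _·_ A∈ B∈
  ∈-products⁺ f g zero    (suc j) A∈ B∈ = ∈-++⁺ˡ (∈-cartesianProductWith⁺ _·_ A∈ B∈)
  ∈-products⁺ f g (suc i) j       A∈ B∈ =
    ∈-++⁺ʳ (cartesianProductWith _·_ (f 0) (g (suc (i + j)))) (∈-products⁺ (f ∘ suc) g i j A∈ B∈)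

  ∈-products⁻ : ∀ f g n {R} → R ∈ products f g n →
                ∃₂ λ A B → ∃₂ λ i j → A ∈ f i × B ∈ g j × i + j ≡ n × R ≡ A · B
  ∈-products⁻ f g zero    R∈ with ∈-cartesianProductWith⁻ _·_ (f 0) (g 0) R∈
  ... | A , B , A∈ , B∈ , eq = A , B , 0 , 0 , A∈ , B∈ , refl , eq
  ∈-products⁻ f g (suc n) R∈ with ∈-++⁻ (cartesianProductWith _·_ (f 0) (g (suc n))) R∈
  ... | inj₁ R∈′ with ∈-cartesianProductWith⁻ _·_ (f 0) (g (suc n)) R∈′
  ...   | A , B , A∈ , B∈ , eq = A , B , 0 , suc n , A∈ , B∈ , refl , eq
  ∈-products⁻ f g (suc n) R∈ | inj₂ R∈′ with ∈-products⁻ (f ∘ suc) g n R∈′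
  ...   | A , B , i , j , A∈ , B∈ , i+j≡n , eq = A , B , suc i , j , A∈ , B∈ , cong suc i+j≡n , eq

  -- By the last hypothesis the left factor of a product determines its index, so distinct summands
  -- share no term.
  products-unique : ∀ f g n → (∀ i → Unique (f i)) → (∀ j → Unique (g j)) →
                    (∀ {i j P} → P ∈ f i → P ∈ f j → i ≡ j) → Unique (products f g n)
  products-unique f g zero    f! g! inj = Unique.cartesianProductWith⁺ _·_ ·-injective (f! 0) (g! 0)
  products-unique f g (suc n) f! g! inj =
    Unique.++⁺ (Unique.cartesianProductWith⁺ _·_ ·-injective (f! 0) (g! (suc n)))
               (products-unique (f ∘ suc) g n (f! ∘ suc) g! (λ p q → suc-injective (inj p q)))
               disjoint
    where
    disjoint : ∀ {R} → ¬ (R ∈ cartesianProductWith _·_ (f 0) (g (suc n)) ×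
                          R ∈ products (f ∘ suc) g n)
    disjoint (p , q) with ∈-cartesianProductWith⁻ _·_ (f 0) (g (suc n)) p
                        | ∈-products⁻ (f ∘ suc) g n q
    ... | _ , _ , A∈ , _ , refl | _ , _ , _ , _ , A∈′ , _ , _ , refl with inj A∈ A∈′
    ...   | ()

  -- Complete for size n only if n is smaller than the fuel.
  enumerate : ℕ → ℕ → List Closed
  enumerate zero       _       = []
  enumerate (suc fuel) zero    = map prim (allFin b)
  enumerate (suc fuel) (suc n) = products (enumerate fuel) (enumerate fuel) n

  ∈-enumerate⁻ : ∀ fuel n {P} → P ∈ enumerate fuel n → size P ≡ n
  ∈-enumerate⁻ (suc fuel) zero    P∈ with ∈-map⁻ prim P∈
  ... | _ , _ , refl = refl
  ∈-enumerate⁻ (suc fuel) (suc n) P∈ with ∈-products⁻ (enumerate fuel) (enumerate fuel) n P∈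
  ... | _ , _ , i , j , A∈ , B∈ , refl , refl =
    cong suc (cong₂ _+_ (∈-enumerate⁻ fuel i A∈) (∈-enumerate⁻ fuel j B∈))

  ∈-enumerate⁺ : ∀ fuel P → size P < fuel → P ∈ enumerate fuel (size P)
  ∈-enumerate⁺ (suc fuel) (prim X) _       = ∈-map⁺ prim (∈-allFin X)
  ∈-enumerate⁺ (suc fuel) (A · B)  (s≤s q) =
    ∈-products⁺ (enumerate fuel) (enumerate fuel) (size A) (size B)
      (∈-enumerate⁺ fuel A (≤-trans (s≤s (m≤m+n (size A) (size B))) q))
      (∈-enumerate⁺ fuel B (≤-trans (s≤s (m≤n+m (size B) (size A))) q))

  enumerate-unique : ∀ fuel n → Unique (enumerate fuel n)
  enumerate-unique zero       n       = []
  enumerate-unique (suc fuel) zero    = Unique.map⁺ (λ { refl → refl }) (Unique.allFin⁺ b)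
  enumerate-unique (suc fuel) (suc n) =
    products-unique (enumerate fuel) (enumerate fuel) n (enumerate-unique fuel) (enumerate-unique fuel)
      (λ {i} {j} p q → trans (sym (∈-enumerate⁻ fuel i p)) (∈-enumerate⁻ fuel j q))

  ofSize : ℕ → List Closed
  ofSize n = enumerate (suc n) n

  ofSize-unique : ∀ n → Unique (ofSize n)
  ofSize-unique n = enumerate-unique (suc n) n

  ∈-ofSize : ∀ n P → P ∈ ofSize n ⇔ size P ≡ n
  ∈-ofSize n P = mk⇔ (∈-enumerate⁻ (suc n) n) λ { refl → ∈-enumerate⁺ (suc n) P ≤-refl }

  count : ℕ → ℕ
  count n = length (ofSize n)

  length≤count : ∀ {n xs} → Unique xs → All (λ P → size P ≡ n) xs → length xs ≤ count n
  length≤count xs! sizes =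
    length-mono-⊆ xs! (λ P∈xs → Equivalence.from (∈-ofSize _ _) (All.lookup sizes P∈xs))

  -- `count` takes different fuel at each size, while one unfolding of `enumerate` uses the same
  -- fuel for all smaller sizes. Any sufficient fuel lists the same terms without repetition, so the
  -- lengths agree.
  length-enumerate : ∀ {fuel n} → n < fuel → length (enumerate fuel n) ≡ count n
  length-enumerate {fuel} {n} n<fuel = ≤-antisym
    (length≤count (enumerate-unique fuel n) (All.tabulate (∈-enumerate⁻ fuel n)))
    (length-mono-⊆ (ofSize-unique n) λ {P} P∈ →
      subst (λ m → P ∈ enumerate fuel m) (∈-enumerate⁻ (suc n) n P∈)
        (∈-enumerate⁺ fuel P (subst (_< fuel) (sym (∈-enumerate⁻ (suc n) n P∈)) n<fuel)))

  count-suc : ∀ n → count (suc n) ≡ conv count count n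
  count-suc n = trans (length-products (enumerate (suc n)) (enumerate (suc n)) n)
                      (conv-cong n (λ _ i≤n → length-enumerate (s≤s i≤n))
                                   (λ _ i≤n → length-enumerate (s≤s i≤n)))

  count-positive : Fin b → ∀ n → 1 ≤ count n
  count-positive X n = subst (λ m → 1 ≤ count m) (size-comb n)
    (∈-length (Equivalence.from (∈-ofSize _ (comb n)) refl))
    where
    comb : ℕ → Closed
    comb zero    = prim X
    comb (suc n) = prim X · comb n

    size-comb : ∀ n → size (comb n) ≡ n
    size-comb zero    = refl
    size-comb (suc n) = cong suc (size-comb n)

-- Inserting a fixed subterm

infix 4 _⊑_

data _⊑_ {P V : Set} (M : Term P V) : Term P V → Set where
  here  : M ⊑ M
  left  : ∀ {A B} → M ⊑ A → M ⊑ A · B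
  right : ∀ {A B} → M ⊑ B → M ⊑ A · B

module Insertion {P V : Set} (_≟_ : DecidableEquality (Term P V)) (M : Term P V) where

  -- M is inserted at a node by replacing the subterm Q of that node by Q · M.
  insertions : Term P V → List (Term P V)
  insertions (prim X) = prim X · M ∷ []
  insertions (var v)  = var v · M ∷ []
  insertions (A · B)  = A · B · M ∷ map (_· B) (insertions A) ++ map (A ·_) (insertions B)

  length-insertions : ∀ Q → length (insertions Q) ≡ 1 + 2 * size Q
  length-insertions (prim X) = refl
  length-insertions (var v)  = refl
  length-insertions (A · B)  = cong suc (begin
    length (map (_· B) (insertions A) ++ map (A ·_) (insertions B))
      ≡⟨ length-++ (map (_· B) (insertions A)) ⟩
    length (map (_· B) (insertions A)) + length (map (A ·_) (insertions B))
      ≡⟨ cong₂ _+_ (trans (length-map _ (insertions A)) (length-insertions A))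
                   (trans (length-map _ (insertions B)) (length-insertions B)) ⟩
    (1 + 2 * size A) + (1 + 2 * size B)
      ≡⟨ lemma (size A) (size B) ⟩
    2 * suc (size A + size B) ∎)
    where
    open ≡-Reasoning
    lemma : ∀ a b → (1 + 2 * a) + (1 + 2 * b) ≡ 2 * (1 + (a + b))
    lemma = solve-∀

  -- A view of membership in `insertions`: `root` merges the first entries of all three clauses, and
  -- the other two constructors locate the insertion below an application.
  data Inserted : Term P V → Term P V → Set where
    root : ∀ {Q} → Inserted Q (Q · M)
    inˡ  : ∀ {A A′ B} → A′ ∈ insertions A → Inserted (A · B) (A′ · B)
    inʳ  : ∀ {A B B′} → B′ ∈ insertions B → Inserted (A · B) (A · B′)

  inserted : ∀ Q {R} → R ∈ insertions Q → Inserted Q R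
  inserted (prim X) (here refl) = root
  inserted (var v)  (here refl) = root
  inserted (A · B)  (here refl) = root
  inserted (A · B)  (there R∈) with ∈-++⁻ (map (_· B) (insertions A)) R∈
  ... | inj₁ R∈ˡ with ∈-map⁻ (_· B) R∈ˡ
  ...   | _ , A′∈ , refl = inˡ A′∈
  inserted (A · B)  (there R∈) | inj₂ R∈ʳ with ∈-map⁻ (A ·_) R∈ʳ
  ...   | _ , B′∈ , refl = inʳ B′∈

  size-insertions : ∀ Q {R} → R ∈ insertions Q → size R ≡ suc (size M) + size Q
  size-insertions Q R∈ with inserted Q R∈
  ... | root = cong suc (+-comm (size Q) (size M))
  ... | inˡ {A} {B = B} A′∈ rewrite size-insertions A A′∈ = lemma (size M) (size A) (size B)
    where
    lemma : ∀ m a b → 1 + ((1 + m + a) + b) ≡ 1 + m + (1 + (a + b))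
    lemma = solve-∀
  ... | inʳ {A} {B} B′∈ rewrite size-insertions B B′∈ = lemma (size M) (size A) (size B)
    where
    lemma : ∀ m a b → 1 + (a + (1 + m + b)) ≡ 1 + m + (1 + (a + b))
    lemma = solve-∀

  -- By size: an insertion result is strictly larger than both `Q` and `M`.
  insertions-≢ : ∀ Q {R} → R ∈ insertions Q → R ≢ Q × R ≢ M
  insertions-≢ Q R∈ =
    (λ { refl → m≢1+n+m (size Q) (size-insertions Q R∈) }) ,
    (λ { refl → m≢1+m+n (size M) (size-insertions Q R∈) })

  erase : Term P V → Term P V
  erase (prim X) = prim X
  erase (var v)  = var v
  erase (A · B) with B ≟ M
  ... | yes _ = A
  ... | no  _ = erase A · erase B

  erase-free : ∀ {Q} → ¬ M ⊑ Q → erase Q ≡ Q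
  erase-free {prim X} _  = refl
  erase-free {var v}  _  = refl
  erase-free {A · B}  M⋢ with B ≟ M
  ... | yes refl = contradiction (right here) M⋢
  ... | no  _    = cong₂ _·_ (erase-free (M⋢ ∘ left)) (erase-free (M⋢ ∘ right))

  -- The only application with argument `M` that `erase` meets is the inserted one: arguments taken
  -- from `Q` differ from `M` because `Q` is `M`-free, and an argument containing the insertion is
  -- too large to be `M`.
  erase-insertions : ∀ {Q} → ¬ M ⊑ Q → ∀ {R} → R ∈ insertions Q → erase R ≡ Q
  erase-insertions {Q} M⋢ R∈ with inserted Q R∈
  ... | root with M ≟ M
  ...   | yes _  = refl
  ...   | no M≢M = contradiction refl M≢M
  erase-insertions M⋢ R∈ | inˡ {B = B} A′∈ with B ≟ M
  ...   | yes refl = contradiction (right here) M⋢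
  ...   | no  _    = cong₂ _·_ (erase-insertions (M⋢ ∘ left) A′∈) (erase-free (M⋢ ∘ right))
  erase-insertions M⋢ R∈ | inʳ {B = B} {B′} B′∈ with B′ ≟ M
  ...   | yes B′≡M = contradiction B′≡M (proj₂ (insertions-≢ B B′∈))
  ...   | no  _    = cong₂ _·_ (erase-free (M⋢ ∘ left)) (erase-insertions (M⋢ ∘ right) B′∈)

  -- Insertion at the root has argument `M`, which is neither `B` nor an insertion into `B`.
  -- Insertion into `A` changes the left factor, whereas insertion into `B` keeps it.
  insertions-unique : ∀ {Q} → ¬ M ⊑ Q → Unique (insertions Q)
  insertions-unique {prim X} _  = [] ∷ []
  insertions-unique {var v}  _  = [] ∷ []
  insertions-unique {A · B}  M⋢ =
    ¬Any⇒All¬ _ root∉ ∷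
    Unique.++⁺ (Unique.map⁺ (proj₁ ∘ ·-injective) (insertions-unique (M⋢ ∘ left)))
               (Unique.map⁺ (proj₂ ∘ ·-injective) (insertions-unique (M⋢ ∘ right)))
               disjoint
    where
    root∉ : ¬ (A · B · M ∈ map (_· B) (insertions A) ++ map (A ·_) (insertions B))
    root∉ R∈ with ∈-++⁻ (map (_· B) (insertions A)) R∈
    ... | inj₁ R∈ˡ with ∈-map⁻ (_· B) R∈ˡ
    ...   | _ , _ , refl = M⋢ (right here)
    root∉ R∈ | inj₂ R∈ʳ with ∈-map⁻ (A ·_) R∈ʳ
    ...   | _ , M∈ , eq = proj₂ (insertions-≢ B M∈) (sym (proj₂ (·-injective eq)))

    disjoint : ∀ {R} → ¬ (R ∈ map (_· B) (insertions A) × R ∈ map (A ·_) (insertions B))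
    disjoint (p , q) with ∈-map⁻ (_· B) p | ∈-map⁻ (A ·_) q
    ... | _ , A′∈ , refl | _ , _ , eq = proj₁ (insertions-≢ A A′∈) (proj₁ (·-injective eq))

module _ {P V : Set} (_≟ᴾ_ : DecidableEquality P) (_≟ⱽ_ : DecidableEquality V) where

  ≟-Term : DecidableEquality (Term P V)
  ≟-Term (prim X) (prim Y) = Dec.map′ (cong prim) (λ { refl → refl }) (X ≟ᴾ Y)
  ≟-Term (prim X) (var w)  = no λ ()
  ≟-Term (prim X) (C · D)  = no λ ()
  ≟-Term (var v)  (prim Y) = no λ ()
  ≟-Term (var v)  (var w)  = Dec.map′ (cong var) (λ { refl → refl }) (v ≟ⱽ w)
  ≟-Term (var v)  (C · D)  = no λ ()
  ≟-Term (A · B)  (prim Y) = no λ ()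
  ≟-Term (A · B)  (var w)  = no λ ()
  ≟-Term (A · B)  (C · D)  =
    Dec.map′ (λ { (refl , refl) → refl }) ·-injective (≟-Term A C ×-dec ≟-Term B D)

-- Density of the combinators avoiding a fixed subterm

module _ (B : Basis) where
  open Basis B
  open Enumeration card
  open Growth count count-suc

  -- Double counting: `erase` tells the insertions into different members of `xs` apart, so all of
  -- them together are distinct terms of one size. `c-+≤` returns to size `n` at the cost of a
  -- constant factor.
  avoiding-bound : ∀ (M : Combinator B) n xs → Unique xs → All (λ P → size P ≡ n × ¬ M ⊑ P) xs →
                   length xs * (1 + 2 * n) ≤ (4 * count 0) ^ suc (size M) * count n
  avoiding-bound M n xs xs! good = begin
    length xs * (1 + 2 * n)
      ≡⟨ length-concatMap insertions (1 + 2 * n)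
           (All.map (λ {P} (eq , _) → trans (length-insertions P) (cong (λ m → 1 + 2 * m) eq)) good) ⟨
    length (concatMap insertions xs)
      ≤⟨ length≤count
           (concatMap-unique insertions erase xs! (All.map (insertions-unique ∘ proj₂) good)
                                                  (All.map (erase-insertions ∘ proj₂) good))
           (All.tabulate sizes) ⟩
    count (suc (size M) + n)
      ≤⟨ c-+≤ (suc (size M)) n ⟩
    (4 * count 0) ^ suc (size M) * count n ∎
    where
    open ≤-Reasoning
    open Insertion (≟-Term Fin._≟_ (λ ())) M

    sizes : ∀ {R} → R ∈ concatMap insertions xs → size R ≡ suc (size M) + n
    sizes R∈ with find (∈-concatMap⁻ insertions {xs = xs} R∈)
    ... | P , P∈xs , R∈P =
      trans (size-insertions P R∈P) (cong (suc (size M) +_) (proj₁ (All.lookup good P∈xs)))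

  almostNo-avoiding : Prim → (M : Combinator B) {A : Combinator B → Set} →
                      (∀ {P} → M ⊑ P → ¬ A P) → AsymptoticallyAlmostNo B A
  -- With `k * D` as threshold, `D * (k * l)` is at most `l * n`, hence below `l * (1 + 2 * n)` and
  -- so below `D * count n`; then `D` cancels.
  almostNo-avoiding X M {A} M⊑⇒¬A k = k * D , λ n n₀≤n →
    count n , (ofSize n , ofSize-unique n , ∈-ofSize n , refl) ,
    λ xs xs! good → bound n n₀≤n (length xs)
      (avoiding-bound M n xs xs! (All.map (λ (eq , AP) → eq , λ M⊑P → M⊑⇒¬A M⊑P AP) good))
    where
    D : ℕ
    D = (4 * count 0) ^ suc (size M)

    bound : ∀ n → k * D ≤ n → ∀ l → l * (1 + 2 * n) ≤ D * count n → k * l < count n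
    -- For `l` zero the chain below is not strict; here the primitive `X` supplies a combinator of
    -- every size.
    bound n _   zero      _ rewrite *-zeroʳ k = count-positive X n
    bound n kD≤n l@(suc _) l≤ = *-cancelˡ-< D _ _ (begin-strict
      D * (k * l)      ≡⟨ lemma D k l ⟩
      l * (k * D)      ≤⟨ *-monoʳ-≤ l kD≤n ⟩
      l * n            <⟨ *-monoʳ-< l (s≤s (m≤m+n n (n + 0))) ⟩
      l * (1 + 2 * n)  ≤⟨ l≤ ⟩
      D * count n      ∎)
      where
      open ≤-Reasoning
      lemma : ∀ D k l → D * (k * l) ≡ l * (k * D)
      lemma = solve-∀

-- Reduction and confluence

headPrim : ∀ {P V : Set} → Term P V → Maybe P
headPrim (prim X) = just X
headPrim (var _)  = nothing
headPrim (M · _)  = headPrim M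

spineLength : ∀ {P V : Set} → Term P V → ℕ
spineLength (prim _) = 0
spineLength (var _)  = 0
spineLength (M · _)  = suc (spineLength M)

module _ {P V : Set} where

  headPrim-applyTo : ∀ (M : Term P V) {m} (Ns : Vec (Term P V) m) →
                     headPrim (applyTo M Ns) ≡ headPrim M
  headPrim-applyTo M []       = refl
  headPrim-applyTo M (N ∷ Ns) = headPrim-applyTo (M · N) Ns

  spineLength-applyTo : ∀ (M : Term P V) {m} (Ns : Vec (Term P V) m) →
                        spineLength (applyTo M Ns) ≡ spineLength M + m
  spineLength-applyTo M []       = sym (+-identityʳ _)
  spineLength-applyTo M (N ∷ Ns) = trans (spineLength-applyTo (M · N) Ns) (sym (+-suc _ _))

  applyTo-injective : ∀ (M M′ : Term P V) {m} (Ns Ns′ : Vec (Term P V) m) →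
                      applyTo M Ns ≡ applyTo M′ Ns′ → M ≡ M′ × Ns ≡ Ns′
  applyTo-injective M M′ []       []         eq = eq , refl
  applyTo-injective M M′ (N ∷ Ns) (N′ ∷ Ns′) eq with applyTo-injective (M · N) (M′ · N′) Ns Ns′ eq
  ... | refl , refl = refl , refl

  size≤applyTo : ∀ (M : Term P V) {m} (Ns : Vec (Term P V) m) → size M ≤ size (applyTo M Ns)
  size≤applyTo M []       = ≤-refl
  size≤applyTo M (N ∷ Ns) =
    ≤-trans (≤-trans (m≤m+n (size M) (size N)) (n≤1+n _)) (size≤applyTo (M · N) Ns)

  -- Licenses the induction on size in `⇛-diamond`, which passes from a redex to its arguments.
  size-arguments : ∀ (M : Term P V) {m} (Ns : Vec (Term P V) m) →
                   Allᵛ (λ N → size N < size (applyTo M Ns)) Ns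
  size-arguments M []       = []
  size-arguments M (N ∷ Ns) =
    ≤-trans (s≤s (m≤n+m (size N) (size M))) (size≤applyTo (M · N) Ns) ∷ size-arguments (M · N) Ns

  ⊑-applyTo : ∀ {L M : Term P V} {m} (Ns : Vec (Term P V) m) → L ⊑ M → L ⊑ applyTo M Ns
  ⊑-applyTo []       L⊑M = L⊑M
  ⊑-applyTo (N ∷ Ns) L⊑M = ⊑-applyTo Ns (left L⊑M)

  bind-closed : ∀ {g : ⊥ → Term P V} {σ : V → Term P ⊥} (N : Term P ⊥) →
                bind prim σ (bind prim g N) ≡ N
  bind-closed (prim X) = refl
  bind-closed (M · N)  = cong₂ _·_ (bind-closed M) (bind-closed N)

bind-applyTo : ∀ {P Q V W : Set} (f : P → Term Q W) (g : V → Term Q W) M {m} (Ns : Vec (Term P V) m) →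
               bind f g (applyTo M Ns) ≡ applyTo (bind f g M) (Vec.map (bind f g) Ns)
bind-applyTo f g M []       = refl
bind-applyTo f g M (N ∷ Ns) = bind-applyTo f g (M · N) Ns

S-type : ∀ {α} → Typing schemeSK (prim 𝐒) α →
         ∃[ a ] ∃[ b ] ∃[ c ] α ≡ (a ⇒ b ⇒ c) ⇒ (a ⇒ b) ⇒ a ⇒ c
S-type (axiom .𝐒 σ) = σ 0 , σ 1 , σ 2 , refl

K-type : ∀ {α} → Typing schemeSK (prim 𝐊) α → ∃[ a ] ∃[ b ] α ≡ a ⇒ b ⇒ a
K-type (axiom .𝐊 σ) = σ 0 , σ 1 , refl

module Rewriting (B : Basis) where
  open Basis B

  arity-positive : (X : Prim) → arity X ≢ 0
  arity-positive X eq = noTerm (subst (λ m → Term ⊥ (Fin m)) eq (rhs X))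
    where
    noTerm : ¬ Term ⊥ (Fin 0)
    noTerm (M · N) = noTerm M

  module _ {V : Set} where

    infix 4 _⟶_ _↠_ _⇛_ _⇛*_

    _⟶_ _↠_ : Term Prim V → Term Prim V → Set
    _⟶_ = Step B
    _↠_ = Star _⟶_

    reduct : ∀ X → Vec (Term Prim V) (arity X) → Term Prim V
    reduct X Ns = bind ⊥-elim (lookup Ns) (rhs X)

    data _⇛_ : Term Prim V → Term Prim V → Set where
      prim : ∀ {X} → prim X ⇛ prim X
      var  : ∀ {v} → var v ⇛ var v
      _·_  : ∀ {M M′ N N′} → M ⇛ M′ → N ⇛ N′ → M · N ⇛ M′ · N′
      -- The equation keeps applyTo out of the index, so that _⇛_ can be matched on.
      fire : ∀ {T} X {Ns Ns′ : Vec (Term Prim V) (arity X)} →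
             T ≡ applyTo (prim X) Ns → Pointwise _⇛_ Ns Ns′ → T ⇛ reduct X Ns′

    _⇛*_ : ∀ {m} → Vec (Term Prim V) m → Vec (Term Prim V) m → Set
    _⇛*_ = Pointwise _⇛_

    ⇛-refl : ∀ {T} → T ⇛ T
    ⇛-refl {prim X} = prim
    ⇛-refl {var v}  = var
    ⇛-refl {M · N}  = ⇛-refl · ⇛-refl

    ⟶⇒⇛ : ∀ {T U} → T ⟶ U → T ⇛ U
    ⟶⇒⇛ (contract X Ns) = fire X {Ns} refl (Pointwise.refl ⇛-refl)
    ⟶⇒⇛ (appˡ R s)      = ⟶⇒⇛ s · ⇛-refl
    ⟶⇒⇛ (appʳ R s)      = ⇛-refl · ⟶⇒⇛ s

    ↠-· : ∀ {M M′ N N′} → M ↠ M′ → N ↠ N′ → M · N ↠ M′ · N′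
    ↠-· r s = Star.gmap (_· _) (appˡ _) r ◅◅ Star.gmap (_ ·_) (appʳ _) s

    ↠-applyTo : ∀ {M M′ m} {Ns Ns′ : Vec (Term Prim V) m} → M ↠ M′ → Pointwise _↠_ Ns Ns′ →
                applyTo M Ns ↠ applyTo M′ Ns′
    ↠-applyTo r []       = r
    ↠-applyTo r (s ∷ ss) = ↠-applyTo (↠-· r s) ss

    ⇛⇒↠  : ∀ {T U} → T ⇛ U → T ↠ U
    ⇛*⇒↠ : ∀ {m} {Ns Ns′ : Vec (Term Prim V) m} → Ns ⇛* Ns′ → Pointwise _↠_ Ns Ns′
    ⇛⇒↠ prim             = ε
    ⇛⇒↠ var              = ε
    ⇛⇒↠ (r · s)          = ↠-· (⇛⇒↠ r) (⇛⇒↠ s)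
    ⇛⇒↠ (fire X {Ns′ = Ns′} refl rs) = ↠-applyTo ε (⇛*⇒↠ rs) ◅◅ contract X Ns′ ◅ ε
    ⇛*⇒↠ []       = []
    ⇛*⇒↠ (r ∷ rs) = ⇛⇒↠ r ∷ ⇛*⇒↠ rs

    -- This is where steps have to be parallel: a right-hand side may copy an argument, and all its
    -- copies reduce at once.
    ⇛-bind : ∀ {m} {Ns Ns′ : Vec (Term Prim V) m} → Ns ⇛* Ns′ → (t : Term ⊥ (Fin m)) →
             bind ⊥-elim (lookup Ns) t ⇛ bind ⊥-elim (lookup Ns′) t
    ⇛-bind rs (var i) = Pointwise.lookup rs i
    ⇛-bind rs (t · u) = ⇛-bind rs t · ⇛-bind rs u

    -- A firing inside the spine has head `X` and consumes `arity X` arguments. The spine has at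
    -- most that many, so the firing uses all of it and `Ns` is exhausted; otherwise the step splits
    -- along the applications.
    spine-inversion : ∀ X M {m} (Ns : Vec (Term Prim V) m) {U} →
      headPrim M ≡ just X → spineLength M + m ≤ arity X → applyTo M Ns ⇛ U →
      (∃₂ λ Ls Ls′ → applyTo M Ns ≡ applyTo (prim X) Ls × Ls ⇛* Ls′ × U ≡ reduct X Ls′) ⊎
      (∃₂ λ M′ Ns′ → M ⇛ M′ × Ns ⇛* Ns′ × U ≡ applyTo M′ Ns′)
    spine-inversion X M []           head≡ len≤ r = inj₂ (_ , [] , r , [] , refl)
    spine-inversion X M {suc m} (N ∷ Ns) head≡ len≤ r
      with spine-inversion X (M · N) Ns head≡ (subst (_≤ arity X) (+-suc _ m) len≤) r
    ... | inj₁ fired                               = inj₁ fired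
    ... | inj₂ (_ , Ns′ , s · t , rs , refl)       = inj₂ (_ , _ , s , t ∷ rs , refl)
    ... | inj₂ (_ , Ns′ , fire Y {Ls} {Ls′} eq ss , rs , refl)
      with just-injective (trans (sym head≡) (trans (cong headPrim eq) (headPrim-applyTo (prim Y) Ls)))
    ...   | refl with Ns | rs
    ...     | []    | [] = inj₁ (Ls , Ls′ , eq , ss , refl)
    ...     | _ ∷ _ | _  = contradiction len≤ (<⇒≱ (begin-strict
      arity X                    ≡⟨ trans (cong spineLength eq) (spineLength-applyTo (prim X) Ls) ⟨
      suc (spineLength M)        <⟨ s≤s (m<m+n (spineLength M) (s≤s z≤n)) ⟩
      suc (spineLength M + _)    ≡⟨ +-suc _ _ ⟨
      spineLength M + _          ∎))
      where open ≤-Reasoning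

    -- Absence of critical pairs: a redex has exactly `arity X` arguments, so a parallel step fires
    -- it at the root or acts inside its arguments only.
    redex-inversion : ∀ X Ns {U} → applyTo (prim X) Ns ⇛ U →
      ∃[ Ns′ ] Ns ⇛* Ns′ × (U ≡ reduct X Ns′ ⊎ U ≡ applyTo (prim X) Ns′)
    redex-inversion X Ns r with spine-inversion X (prim X) Ns refl ≤-refl r
    ... | inj₁ (Ls , Ls′ , eq , rs , U≡)
      with refl ← proj₂ (applyTo-injective _ _ Ns Ls eq) = Ls′ , rs , inj₁ U≡
    ... | inj₂ (_ , Ns′ , prim , rs , U≡) = Ns′ , rs , inj₂ U≡
    -- The bare `prim X` would be a redex without arguments, but arities are positive.
    ... | inj₂ (_ , Ns′ , fire Y {Ls} eq _ , _ , _) =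
      contradiction (sym (trans (cong spineLength eq) (spineLength-applyTo (prim Y) Ls)))
                    (arity-positive Y)

    -- The method of Tait and Martin-Löf, by induction on the size bound `k`. If either step fires
    -- at the root, `fire-diamond` first joins the arguments and then fires wherever the redex is
    -- still present; two congruence steps are joined componentwise.
    ⇛-diamond  : ∀ k {T U U′} → size T < k → T ⇛ U → T ⇛ U′ → ∃[ W ] U ⇛ W × U′ ⇛ W
    ⇛*-diamond : ∀ k {m} {Ns Ls Ls′ : Vec (Term Prim V) m} → Allᵛ (λ N → size N < k) Ns →
                 Ns ⇛* Ls → Ns ⇛* Ls′ → ∃[ Ws ] Ls ⇛* Ws × Ls′ ⇛* Ws
    fire-diamond : ∀ k X {T Ns Ls U} → size T ≤ k → T ≡ applyTo (prim X) Ns → Ns ⇛* Ls →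
                   T ⇛ U → ∃[ W ] reduct X Ls ⇛ W × U ⇛ W

    ⇛*-diamond k []       []       []       = [] , [] , []
    ⇛*-diamond k (p ∷ ps) (r ∷ rs) (s ∷ ss) with ⇛-diamond k p r s | ⇛*-diamond k ps rs ss
    ... | _ , r′ , s′ | _ , rs′ , ss′ = _ , r′ ∷ rs′ , s′ ∷ ss′

    fire-diamond k X {Ns = Ns} T≤k refl rs s with redex-inversion X Ns s
    ... | Ls′ , ss , U≡
      with ⇛*-diamond k (Allᵛ.map (λ p → <-≤-trans p T≤k) (size-arguments (prim X) Ns)) rs ss
    ...   | Ws , rs′ , ss′ with U≡
    ...     | inj₁ refl = _ , ⇛-bind rs′ (rhs X) , ⇛-bind ss′ (rhs X)
    ...     | inj₂ refl = _ , ⇛-bind rs′ (rhs X) , fire X refl ss′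

    ⇛-diamond (suc k) T<k prim           s = _ , s , ⇛-refl
    ⇛-diamond (suc k) T<k var            s = _ , s , ⇛-refl
    ⇛-diamond (suc k) T<k (fire X eq rs) s = fire-diamond k X (s≤s⁻¹ T<k) eq rs s
    ⇛-diamond (suc k) T<k r@(_ · _) (fire X eq ss) with fire-diamond k X (s≤s⁻¹ T<k) eq ss r
    ... | W , s′ , r′ = W , r′ , s′
    ⇛-diamond (suc k) {M · N} (s≤s T≤k) (r₁ · r₂) (s₁ · s₂)
      with ⇛-diamond k (≤-trans (s≤s (m≤m+n (size M) (size N))) T≤k) r₁ s₁
         | ⇛-diamond k (≤-trans (s≤s (m≤n+m (size N) (size M))) T≤k) r₂ s₂
    ... | _ , r₁′ , s₁′ | _ , r₂′ , s₂′ = _ , r₁′ · r₂′ , s₁′ · s₂′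

    ⇛-strip : ∀ {T U U′} → T ⇛ U → Star _⇛_ T U′ → ∃[ W ] Star _⇛_ U W × U′ ⇛ W
    ⇛-strip r ε        = _ , ε , r
    ⇛-strip r (s ◅ ss) with ⇛-diamond _ ≤-refl r s
    ... | _ , s′ , r′ with ⇛-strip r′ ss
    ...   | _ , ss′ , r″ = _ , s′ ◅ ss′ , r″

    ⇛-confluent : Confluent _⇛_
    ⇛-confluent ε        ss = _ , ss , ε
    ⇛-confluent (r ◅ rs) ss with ⇛-strip r ss
    ... | _ , ss′ , r′ with ⇛-confluent rs ss′
    ...   | _ , rs″ , ss″ = _ , rs″ , r′ ◅ ss″

    ⟶-confluent : Confluent _⟶_
    ⟶-confluent rs ss with ⇛-confluent (Star.map ⟶⇒⇛ rs) (Star.map ⟶⇒⇛ ss)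
    ... | W , rs′ , ss′ = W , Star.concat (Star.map ⇛⇒↠ rs′) , Star.concat (Star.map ⇛⇒↠ ss′)

    -- Shows that primitive-free terms, such as `x z (y z)` and `x`, are normal.
    ⟶-prim⊑ : ∀ {T U} → T ⟶ U → ∃[ X ] prim X ⊑ T
    ⟶-prim⊑ (contract X Ns) = X , ⊑-applyTo Ns here
    ⟶-prim⊑ (appˡ R s) with ⟶-prim⊑ s
    ... | X , X⊑ = X , left X⊑
    ⟶-prim⊑ (appʳ R s) with ⟶-prim⊑ s
    ... | X , X⊑ = X , right X⊑

    ⊑-reducible : ∀ {T U P} → T ⊑ P → T ⟶ U → ∃[ Q ] P ⟶ Q
    ⊑-reducible here        s = _ , s
    ⊑-reducible (left T⊑P)  s with ⊑-reducible T⊑P s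
    ... | _ , s′ = _ , appˡ _ s′
    ⊑-reducible (right T⊑P) s with ⊑-reducible T⊑P s
    ... | _ , s′ = _ , appʳ _ s′

  -- Substitution and the reductions of the representatives of S and K

  bind-reduct : ∀ {V W : Set} (σ : V → Term Prim W) {m} (Ns : Vec (Term Prim V) m) t →
    bind prim σ (bind ⊥-elim (lookup Ns) t) ≡ bind ⊥-elim (lookup (Vec.map (bind prim σ) Ns)) t
  bind-reduct σ Ns (var i) = sym (lookup-map i (bind prim σ) Ns)
  bind-reduct σ Ns (t · u) = cong₂ _·_ (bind-reduct σ Ns t) (bind-reduct σ Ns u)

  -- Carries reductions of open terms such as `N x y z`, obtained from confluence, over to arbitrary
  -- closed arguments.
  ⟶-bind : ∀ {V W : Set} (σ : V → Term Prim W) {T U} → T ⟶ U → bind prim σ T ⟶ bind prim σ U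
  ⟶-bind σ (contract X Ns) =
    subst₂ _⟶_ (sym (bind-applyTo prim σ (prim X) Ns)) (sym (bind-reduct σ Ns (rhs X)))
      (contract X (Vec.map (bind prim σ) Ns))
  ⟶-bind σ (appˡ R s) = appˡ _ (⟶-bind σ s)
  ⟶-bind σ (appʳ R s) = appʳ _ (⟶-bind σ s)

  infix 4 _⟶⁺_

  _⟶⁺_ : Combinator B → Combinator B → Set
  P ⟶⁺ Q = ∃[ R ] P ⟶ R × R ↠ Q

  ⟶⁺-↠ : ∀ {P Q R} → P ⟶⁺ Q → Q ↠ R → P ⟶⁺ R
  ⟶⁺-↠ (_ , s , r) r′ = _ , s , r ◅◅ r′

  ⟶⁺⇒↠ : ∀ {P Q} → P ⟶⁺ Q → P ↠ Q
  ⟶⁺⇒↠ (_ , s , r) = s ◅ r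

  private
    assign : Combinator B → Combinator B → Combinator B → Fin 3 → Combinator B
    assign P Q R = lookup (P ∷ Q ∷ R ∷ [])

  S-reduces : ∀ {N} → ExtEqS B N → ∀ P Q R → N · P · Q · R ⟶⁺ P · R · (Q · R)
  S-reduces {N} eqS P Q R
    with conf⇒nf ⟶-confluent normal eqS
    where
    normal : ∀ {x y z} → ¬ ∃ λ U → var {V = Fin 3} x · var z · (var y · var z) ⟶ U
    normal (_ , s) with ⟶-prim⊑ s
    ... | _ , left (left ())
    ... | _ , left (right ())
    ... | _ , right (left ())
    ... | _ , right (right ())
  -- ε is excluded because z and y · z differ: this makes the cycle of Ω a proper one.
  ... | s ◅ r = _ , subst (λ N′ → N′ · P · Q · R ⟶ _) (bind-closed N) (⟶-bind (assign P Q R) s)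
                  , Star.gmap (bind prim (assign P Q R)) (⟶-bind _) r

  K-reduces : ∀ {M} → ExtEqK B M → ∀ P Q → M · P · Q ↠ P
  K-reduces {M} eqK P Q =
    subst (λ M′ → M′ · P · Q ↠ P) (bind-closed M)
      -- The third value is a filler: `z` does not occur in the equation for K.
      (Star.gmap (bind prim (assign P Q Q)) (⟶-bind _) (conf⇒nf ⟶-confluent normal eqK))
    where
    normal : ∀ {x : Fin 3} → ¬ ∃ λ U → var x ⟶ U
    normal (_ , s) with ⟶-prim⊑ s
    ... | _ , ()

  -- Divergence, and the combinators ω and Ω

  Diverges : Combinator B → Set
  Diverges P = Σ (ℕ → Combinator B) λ f → f 0 ≡ P × (∀ i → f i ⟶ f (suc i))

  ⊑-diverges : ∀ {P Q} → P ⊑ Q → Diverges P → Diverges Q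
  ⊑-diverges here        d = d
  ⊑-diverges (left {B = R} P⊑A) d with ⊑-diverges P⊑A d
  ... | f , refl , steps = (λ i → f i · R) , refl , λ i → appˡ R (steps i)
  ⊑-diverges (right {A = R} P⊑B) d with ⊑-diverges P⊑B d
  ... | f , refl , steps = (λ i → R · f i) , refl , λ i → appʳ R (steps i)

  -- `state` holds the current term with the rest of its path back to `P`; when that path is used up
  -- the term is `P`, and the cycle starts again.
  cycle-diverges : ∀ {P} → P ⟶⁺ P → Diverges P
  cycle-diverges {P} (R , P⟶R , R↠P) = proj₁ ∘ state , refl , λ i → next-step (state i)
    where
    next : (∃ λ Q → Q ↠ P) → ∃ λ Q → Q ↠ P
    next (_ , ε)     = R , R↠P
    next (_ , s ◅ r) = _ , r

    next-step : ∀ q → proj₁ q ⟶ proj₁ (next q)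
    next-step (_ , ε)     = P⟶R
    next-step (_ , s ◅ _) = s

    state : ℕ → ∃ λ Q → Q ↠ P
    state zero    = P , ε
    state (suc i) = next (state i)

  module _ (N M : Combinator B) (eqS : ExtEqS B N) (eqK : ExtEqK B M) where

    I ω Ω : Combinator B
    I = N · M · M
    ω = N · I · I
    Ω = ω · ω

    I-reduces : ∀ P → I · P ↠ P
    I-reduces P = ⟶⁺⇒↠ (S-reduces eqS M M P) ◅◅ K-reduces eqK P (M · P)

    -- `N I I ω` reduces to `I ω (I ω)`, and both factors reduce to `ω`.
    Ω-cycle : Ω ⟶⁺ Ω
    Ω-cycle = ⟶⁺-↠ (S-reduces eqS I I ω) (↠-· (I-reduces ω) (I-reduces ω))

    module _ {τ : Prim → Type} (incl : SoundInclusion B τ) where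

      -- The first `M` receives a type `a ⇒ b ⇒ c`, which as a type of K has `c` equal to `a`; what
      -- remains for `I` is `a ⇒ c`.
      I-type : ∀ {α} → Typing τ I α → ∃[ β ] α ≡ β ⇒ β
      I-type (mp (mp t u) v) with S-type (proj₁ incl N eqS _ t)
      ... | _ , _ , _ , refl with K-type (proj₂ incl M eqK _ u)
      ...   | _ , _ , refl = _ , refl

      -- The two copies of `I` need types `a ⇒ b ⇒ c` and `a ⇒ b`. By `I-type`, `a` is both `b ⇒ c`
      -- and `b`, impossible for finite types.
      ω-untypeable : ¬ Typeable B τ ω
      ω-untypeable (α , mp (mp t u) v) with S-type (proj₁ incl N eqS _ t)
      ... | _ , _ , _ , refl with I-type u | I-type v
      ...   | _ , refl | _ , ()

  ⊑-typeable : ∀ {τ P Q} → P ⊑ Q → Typeable B τ Q → Typeable B τ P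
  ⊑-typeable here        t              = t
  ⊑-typeable (left P⊑A)  (_ , mp t _)   = ⊑-typeable P⊑A (_ , t)
  ⊑-typeable (right P⊑B) (_ , mp _ t)   = ⊑-typeable P⊑B (_ , t)

  somePrim : Combinator B → Prim
  somePrim (prim X) = X
  somePrim (M · N)  = somePrim M

corollary16 : (B : Basis) → TuringComplete B →
    AsymptoticallyAlmostNo B (NormalForm B) ×
    AsymptoticallyAlmostNo B (StronglyNormalising B) ×
    ((τ : Basis.Prim B → Type) → Sound B τ → AsymptoticallyAlmostNo B (Typeable B τ)) ×
    ((τ : Basis.Prim B → Type) → SoundInclusion B τ → AsymptoticallyAlmostNo B (Typeable B τ))
corollary16 B ((N , eqS) , (M , eqK)) =
  -- A closed redex: `X` applied to `arity X` copies of itself.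
  almostNo-avoiding B X (applyTo (prim X) (replicate (Basis.arity B X) (prim X)))
    (λ ⊑P nf → nf (⊑-reducible ⊑P (contract X (replicate (Basis.arity B X) (prim X))))) ,
  almostNo-avoiding B X (Ω N M eqS eqK)
    (λ ⊑P sn → sn (⊑-diverges ⊑P (cycle-diverges (Ω-cycle N M eqS eqK)))) ,
  (λ τ (soundS , soundK) → almostNo-typeable τ
    ((λ N eqS α → Equivalence.to (soundS N eqS α)) , (λ M eqK α → Equivalence.to (soundK M eqK α)))) ,
  almostNo-typeable
  where
  open Rewriting B
  -- The representative of S has a leaf, so the basis is nonempty.
  X = somePrim N

  almostNo-typeable : (τ : Basis.Prim B → Type) → SoundInclusion B τ →
                      AsymptoticallyAlmostNo B (Typeable B τ)
  almostNo-typeable τ incl = almostNo-avoiding B X (ω N M eqS eqK)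
    (λ ⊑P t → ω-untypeable N M eqS eqK incl (⊑-typeable ⊑P t))
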